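{- Let $G$ be a finite group acting on a sandpile graph $\Gamma=(V,E,\mathrm{wt},s)$. Then the collection of symmetric recurrent configurations on $\Gamma$ (recurrent configurations $c$ with $gc=c$ for all $g\in G$) forms a subgroup of the sandpile group $\mathcal{S}(\Gamma)$.
   Context: Sandpile graph: $\Gamma=(V,E,\mathrm{wt},s)$ is a finite directed graph with edge-weight function $\mathrm{wt}\colon V\times V\to\mathbb{N}=\{0,1,2,\dots\}$, $\mathrm{wt}(v,w)>0$ iff $(v,w)\in E$, and a vertex $s$ (the sink) such that every vertex has a directed path to $s$. Let $\widetilde V=V\setminus\{s\}$ and $\mathrm{outdeg}(v)=\sum_{w\in V}\mathrm{wt}(v,w)$. Configurations: a configuration is an element $c=\sum_{v\in\widetilde V}c_v v\in\mathbb{N}\widetilde V$. A vertex $v\in\widetilde V$ is unstable in $c$ if $c_v\ge\mathrm{outdeg}(v)$; firing it replaces $c$ by $c-\mathrm{outdeg}(v)v+\sum_{w\in\widetilde V}\mathrm{wt}(v,w)w$. Repeatedly firing unstable vertices leads in finitely many steps to a stable configuration (no unstable vertices) $c^\circ$, independent of the choices made. A configuration $c$ is recurrent if it is stable and for every configuration $a$ there is a configuration $b$ with $(a+b)^\circ=c$. The recurrent configurations form a group under $(a,b)\mapsto(a+b)^\circ$, the sandpile group $\mathcal{S}(\Gamma)$. Action: an action of $G$ on $\Gamma$ is an action of $G$ on the set $V$ with $gs=s$ for all $g\in G$ and such that $(v,w)\in E$ implies $(gv,gw)\in E$ with both edges having the same weight. It extends linearly to configurations. -}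

module Defs where

open import Algebra.Bundles using (Group)
import Algebra.Properties.CommutativeMonoid.Sum as CMSum
import Algebra.Properties.Semiring.Sum as SemiringSum
open import Data.Bool.Base using (if_then_else_; true; false)
open import Data.Empty using (⊥-elim-irr)
open import Data.Fin.Base using (Fin; zero; suc)
import Data.Fin.Properties as Fin
open import Data.Irrelevant using ([_])
open import Data.Nat.Base hiding (_⊔_)
open import Data.Nat.Induction using (<-wellFounded)
open import Data.Nat.Properties
open import Data.Nat.Tactic.RingSolver using (solve-∀)
open import Data.Product.Base using (Σ; ∃; _×_; _,_; proj₁; proj₂)
open import Data.Refinement.Base using (Refinement-syntax; _,_; value)
open import Data.Sum.Base using (_⊎_; inj₁; inj₂)
open import Function.Base using (_∘_; _on_)
open import Function.Bundles using (Inverse)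
open import Induction.WellFounded using (Acc; acc)
open import Level using (Level; 0ℓ; _⊔_)
open import Relation.Binary.Construct.Closure.ReflexiveTransitive using (Star; ε; _◅_)
open import Relation.Binary.PropositionalEquality
open import Relation.Nullary.Decidable.Core using (Dec; yes; no; does; _×-dec_; _⊎-dec_)
open import Relation.Nullary.Negation.Core using (¬_; contradiction)
open import Relation.Unary using (Pred)

private
  variable
    a ℓ p : Level

Finite : Group a ℓ → Set (a ⊔ ℓ)
Finite G = ∃ λ m → Inverse (Group.setoid G) (setoid (Fin m))

-- A subset of a group is a predicate respecting the group's setoid equality.
record IsSubgroup (G : Group a ℓ) (P : Pred (Group.Carrier G) p) : Set (a ⊔ ℓ ⊔ p) where
  open Group G using (_≈_; _∙_; _⁻¹) renaming (ε to 1#)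
  field
    respects  : ∀ {x y} → x ≈ y → P x → P y
    ε-closed  : P 1#
    ∙-closed  : ∀ {x y} → P x → P y → P (x ∙ y)
    ⁻¹-closed : ∀ {x} → P x → P (x ⁻¹)

open SemiringSum +-*-semiring using (sum; sum-cong-≗; *-distribˡ-sum; *-distribʳ-sum)
open CMSum +-0-commutativeMonoid using (∑-distrib-+)

-- The vertex set is Fin order.  Loops are allowed, and so are edges leaving the sink.
record SandpileGraph : Set where
  field
    order : ℕ

  V : Set
  V = Fin order

  field
    wt   : V → V → ℕ
    sink : V

  Edge : V → V → Set
  Edge v w = 0 < wt v w

  field
    sink-reachable : ∀ v → Star Edge v sink

  outdeg : V → ℕ
  outdeg v = sum (wt v)

  -- The second component is irrelevant, so these are compared by their underlying vertex.
  Ṽ : Set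
  Ṽ = [ v ∈ V ∣ v ≢ sink ]

  nonsink : (v : Ṽ) → value v ≢ sink
  nonsink (v , [ v≢s ]) v≡s = ⊥-elim-irr (v≢s v≡s)

private
  sum-mono : ∀ {n} {f g : Fin n → ℕ} → (∀ i → f i ≤ g i) → sum f ≤ sum g
  sum-mono {zero}  f≤g = z≤n
  sum-mono {suc n} f≤g = +-mono-≤ (f≤g zero) (sum-mono (f≤g ∘ suc))

  sum-mono-< : ∀ {n} {f g : Fin n → ℕ} → (∀ i → f i ≤ g i) → ∀ i → f i < g i → sum f < sum g
  sum-mono-< f≤g zero    fi<gi = +-mono-<-≤ fi<gi (sum-mono (f≤g ∘ suc))
  sum-mono-< f≤g (suc i) fi<gi = +-mono-≤-< (f≤g zero) (sum-mono-< (f≤g ∘ suc) i fi<gi)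

  entry≤sum : ∀ {n} (f : Fin n → ℕ) i → f i ≤ sum f
  entry≤sum f zero    = m≤m+n _ _
  entry≤sum f (suc i) = ≤-trans (entry≤sum (f ∘ suc) i) (m≤n+m _ _)

module Sandpile (Γ : SandpileGraph) where
  open SandpileGraph Γ

  -- Configurations are compared pointwise, with _≗_.
  Config : Set
  Config = Ṽ → ℕ

  infixl 6 _⊕_
  _⊕_ : Config → Config → Config
  (c ⊕ d) v = c v + d v

  Unstable : Config → Ṽ → Set
  Unstable c v = outdeg (value v) ≤ c v

  Stable : Config → Set
  Stable c = ∀ v → ¬ Unstable c v

  loss : Ṽ → V → ℕ
  loss v w = if does (value v Fin.≟ w) then outdeg (value v) else 0

  -- The subtraction is not truncated when v is unstable in c, the only case in which
  -- firing is used.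
  fire : Ṽ → Config → Config
  fire v c w = (c w ∸ loss v (value w)) + wt (value v) (value w)

  -- Sequences of firings of unstable vertices, with endpoints taken up to _≗_.
  infix 4 _⟶*_
  data _⟶*_ (c d : Config) : Set where
    done : c ≗ d → c ⟶* d
    step : ∀ v → Unstable c v → fire v c ⟶* d → c ⟶* d

  fire-cong : ∀ v {c d} → c ≗ d → fire v c ≗ fire v d
  fire-cong v c≗d w = cong (λ x → (x ∸ loss v (value w)) + wt (value v) (value w)) (c≗d w)

  ⟶*-respˡ : ∀ {c c′ d} → c ≗ c′ → c ⟶* d → c′ ⟶* d
  ⟶*-respˡ eq (done c≗d)   = done (λ v → trans (sym (eq v)) (c≗d v))
  ⟶*-respˡ eq (step v u r) =
    step v (subst (outdeg (value v) ≤_) (eq v) u) (⟶*-respˡ (fire-cong v eq) r)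

  ⟶*-trans : ∀ {b c d} → b ⟶* c → c ⟶* d → b ⟶* d
  ⟶*-trans (done b≗c)   s = ⟶*-respˡ (λ v → sym (b≗c v)) s
  ⟶*-trans (step v u r) s = step v u (⟶*-trans r s)

  private
    loss≤ : ∀ {c} v → Unstable c v → ∀ w → loss v (value w) ≤ c w
    loss≤ v u w with value v Fin.≟ value w
    ... | yes refl = u
    ... | no  _    = z≤n

    swap-last : ∀ x y z → (x + y) + z ≡ (x + z) + y
    swap-last = solve-∀

  fire-⊕ : ∀ {c} v d → Unstable c v → fire v (c ⊕ d) ≗ fire v c ⊕ d
  fire-⊕ {c} v d u w = trans
    (cong (_+ wt (value v) (value w)) (+-∸-comm (d w) (loss≤ {c} v u w)))
    (swap-last (c w ∸ loss v (value w)) (d w) (wt (value v) (value w)))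

  ⟶*-⊕ : ∀ {c c′} d → c ⟶* c′ → c ⊕ d ⟶* c′ ⊕ d
  ⟶*-⊕ d (done eq)        = done (λ v → cong (_+ d v) (eq v))
  ⟶*-⊕ {c} d (step v u r) = step v (≤-trans u (m≤m+n _ _))
    (⟶*-respˡ (λ w → sym (fire-⊕ {c} v d u w)) (⟶*-⊕ d r))

  unstable-fire : ∀ {c u v} → value u ≢ value v → Unstable c v → Unstable (fire u c) v
  unstable-fire {c} {u} {v} u≢v uv with value u Fin.≟ value v
  ... | yes u≡v = contradiction u≡v u≢v
  ... | no  _   = ≤-trans uv (m≤m+n _ _)

  fire-comm : ∀ {c u v} → value u ≢ value v → Unstable c u → Unstable c v →
              fire u (fire v c) ≗ fire v (fire u c)
  fire-comm {c} {u} {v} u≢v uu uv w with value u Fin.≟ value w | value v Fin.≟ value w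
  ... | yes refl | yes refl = contradiction refl u≢v
  ... | yes refl | no _     = trans
    (cong (_+ wt (value u) (value w)) (+-∸-comm _ uu))
    (swap-last (c w ∸ outdeg (value w)) (wt (value v) (value w)) (wt (value w) (value w)))
  ... | no _     | yes refl = sym (trans
    (cong (_+ wt (value v) (value w)) (+-∸-comm _ uv))
    (swap-last (c w ∸ outdeg (value w)) (wt (value u) (value w)) (wt (value w) (value w))))
  ... | no _     | no _     = swap-last (c w) (wt (value v) (value w)) (wt (value u) (value w))

  fire-first : ∀ {c d v} → Stable d → Unstable c v → c ⟶* d → fire v c ⟶* d
  fire-first {v = v} st uv (done eq) = contradiction (subst (outdeg (value v) ≤_) (eq v) uv) (st v)
  fire-first {c} {v = v} st uv (step u uu r) with value u Fin.≟ value v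
  ... | yes refl = r
  ... | no  u≢v  = step u (unstable-fire {c} {v} {u} (u≢v ∘ sym) uu)
    (⟶*-respˡ (fire-comm {c} {v} {u} (u≢v ∘ sym) uv uu)
              (fire-first {v = v} st (unstable-fire {c} {u} {v} u≢v uv) r))

  stable-unique : ∀ {c d d′} → c ⟶* d → Stable d → c ⟶* d′ → Stable d′ → d ≗ d′
  stable-unique (done c≗d) st (done c≗d′)  st′ v = trans (sym (c≗d v)) (c≗d′ v)
  stable-unique (done c≗d) st (step u uu _) st′  = contradiction (subst (outdeg (value u) ≤_) (c≗d u) uu) (st u)
  stable-unique (step v uv r) st r′ st′ = stable-unique r st (fire-first st′ uv r′) st′

  -- Termination: a potential h : V → ℕ with
  -- Σ_w wt(v,w) h(w) < outdeg(v) h(v) for every v ≠ sink, so that Σ_v c_v h(v) drops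
  -- with each firing.  It is built from the distances to the sink.
  private
    Within : ℕ → V → Set
    Within zero    v = v ≡ sink
    Within (suc k) v = Within k v ⊎ ∃ λ w → Edge v w × Within k w

    within? : ∀ k v → Dec (Within k v)
    within? zero    v = v Fin.≟ sink
    within? (suc k) v = within? k v ⊎-dec Fin.any? λ w → (0 <? wt v w) ×-dec within? k w

    within-+ : ∀ j {k v} → Within k v → Within (j + k) v
    within-+ zero    x = x
    within-+ (suc j) x = inj₁ (within-+ j x)

    within-≤ : ∀ {j k v} → j ≤ k → Within j v → Within k v
    within-≤ {j} {k} {v} j≤k x = subst (λ m → Within m v) (m∸n+n≡m j≤k) (within-+ (k ∸ j) x)

    path⇒within : ∀ {v} → Star Edge v sink → ∃ λ k → Within k v
    path⇒within ε       = 0 , refl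
    path⇒within (e ◅ p) = let k , x = path⇒within p in suc k , inj₂ (_ , e , x)

    radius : ℕ
    radius = sum λ v → proj₁ (path⇒within (sink-reachable v))

    within-radius : ∀ v → Within radius v
    within-radius v = within-≤ (entry≤sum (λ v → proj₁ (path⇒within (sink-reachable v))) v)
                               (proj₂ (path⇒within (sink-reachable v)))

    far : ℕ → V → ℕ
    far k v = if does (within? k v) then 0 else 1

    far≤1 : ∀ k v → far k v ≤ 1
    far≤1 k v with does (within? k v)
    ... | true  = z≤n
    ... | false = ≤-refl

    far-no : ∀ k {v} → ¬ Within k v → far k v ≡ 1
    far-no k {v} n with within? k v
    ... | yes x = contradiction x n
    ... | no  _ = refl

    far-yes : ∀ k {v} → Within k v → far k v ≡ 0
    far-yes k {v} y with within? k v
    ... | yes _ = refl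
    ... | no  n = contradiction y n

    K : ℕ
    K = suc (sum outdeg)

    h : ℕ → V → ℕ
    h zero    v = 0
    h (suc k) v = K * h k v + far k v

    h-max : ∀ k {v} → ¬ Within k v → ∀ w → h k w ≤ h k v
    h-max zero    n w = z≤n
    h-max (suc k) {v} n w = +-mono-≤ (*-monoʳ-≤ K (h-max k (n ∘ inj₁) w))
      (subst (far k w ≤_) (sym (far-no k (n ∘ inj₁))) (far≤1 k w))

    outflow : ℕ → V → ℕ
    outflow k v = sum λ w → wt v w * h k w

    farflow : ℕ → V → ℕ
    farflow k v = sum λ w → wt v w * far k w

    wt*far≤wt : ∀ k v w → wt v w * far k w ≤ wt v w
    wt*far≤wt k v w = subst (wt v w * far k w ≤_) (*-identityʳ _) (*-monoʳ-≤ (wt v w) (far≤1 k w))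

    outflow-suc : ∀ k v → outflow (suc k) v ≡ K * outflow k v + farflow k v
    outflow-suc k v = begin
      sum (λ w → wt v w * (K * h k w + far k w))
        ≡⟨ sum-cong-≗ (λ w → rearr (wt v w) K (h k w) (far k w)) ⟩
      sum (λ w → K * (wt v w * h k w) + wt v w * far k w)
        ≡⟨ ∑-distrib-+ (λ w → K * (wt v w * h k w)) (λ w → wt v w * far k w) ⟩
      sum (λ w → K * (wt v w * h k w)) + farflow k v
        ≡⟨ cong (_+ farflow k v) (sym (*-distribˡ-sum K (λ w → wt v w * h k w))) ⟩
      K * outflow k v + farflow k v ∎
      where
      open ≡-Reasoning
      rearr : ∀ x y z t → x * (y * z + t) ≡ y * (x * z) + x * t
      rearr = solve-∀

    superharmonic : ∀ k {v} → v ≢ sink → Within k v → outflow k v < outdeg v * h k v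
    superharmonic zero    v≢s x = contradiction x v≢s
    superharmonic (suc k) {v} v≢s x with within? k v
    ... | yes y = begin-strict
      outflow (suc k) v                 ≡⟨ outflow-suc k v ⟩
      K * outflow k v + farflow k v     <⟨ +-monoʳ-< (K * outflow k v) farflow<K ⟩
      K * outflow k v + K               ≡⟨ rearr₁ K (outflow k v) ⟩
      K * suc (outflow k v)             ≤⟨ *-monoʳ-≤ K (superharmonic k v≢s y) ⟩
      K * (outdeg v * h k v)            ≡⟨ rearr₂ K (outdeg v) (h k v) ⟩
      outdeg v * (K * h k v + 0)        ∎
      where
      open ≤-Reasoning
      rearr₁ : ∀ x y → x * y + x ≡ x * suc y
      rearr₁ = solve-∀
      rearr₂ : ∀ x y z → x * (y * z) ≡ y * (x * z + 0)
      rearr₂ = solve-∀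
      farflow<K : farflow k v < K
      farflow<K = s≤s (≤-trans (sum-mono (wt*far≤wt k v)) (entry≤sum outdeg v))
    superharmonic (suc k) {v} v≢s (inj₁ y) | no n = contradiction y n
    superharmonic (suc k) {v} v≢s (inj₂ (u , e , y)) | no n = begin-strict
      outflow (suc k) v                     ≡⟨ outflow-suc k v ⟩
      K * outflow k v + farflow k v         <⟨ +-monoʳ-< (K * outflow k v) farflow<outdeg ⟩
      K * outflow k v + outdeg v            ≤⟨ +-monoˡ-≤ (outdeg v) (*-monoʳ-≤ K outflow≤) ⟩
      K * (outdeg v * h k v) + outdeg v     ≡⟨ rearr K (outdeg v) (h k v) ⟩
      outdeg v * (K * h k v + 1)            ∎
      where
      open ≤-Reasoning
      rearr : ∀ x y z → x * (y * z) + y ≡ y * (x * z + 1)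
      rearr = solve-∀
      outflow≤ : outflow k v ≤ outdeg v * h k v
      outflow≤ = subst (outflow k v ≤_) (sym (*-distribʳ-sum (h k v) (wt v)))
        (sum-mono λ w → *-monoʳ-≤ (wt v w) (h-max k n w))
      farflow<outdeg : farflow k v < outdeg v
      farflow<outdeg = sum-mono-< (wt*far≤wt k v) u
        (subst (_< wt v u) (sym (trans (cong (wt v u *_) (far-yes k y)) (*-zeroʳ (wt v u)))) e)

    height : V → ℕ
    height = h radius

    extend : Config → V → ℕ
    extend c v with v Fin.≟ sink
    ... | yes _  = 0
    ... | no v≢s = c (v , [ v≢s ])

    potential : Config → ℕ
    potential c = sum λ v → extend c v * height v

    debit : Ṽ → V → ℕ
    debit v w = if does (value v Fin.≟ w) then outdeg (value v) * height w else 0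

    debit-self : ∀ v → outdeg (value v) * height (value v) ≤ debit v (value v)
    debit-self v with value v Fin.≟ value v
    ... | yes _ = ≤-refl
    ... | no  n = contradiction refl n

    fire-entry : ∀ {c} v → Unstable c v → ∀ w →
      extend (fire v c) w * height w + debit v w ≤ extend c w * height w + wt (value v) w * height w
    fire-entry {c} v@(x , [ x≢s ]) u w with w Fin.≟ sink
    fire-entry {c} (x , [ x≢s ]) u w | yes w≡s with x Fin.≟ w
    ... | yes x≡w = contradiction (trans x≡w w≡s) (nonsink (x , [ x≢s ]))
    ... | no  _   = z≤n
    fire-entry {c} (x , [ x≢s ]) u w | no w≢s with x Fin.≟ w
    ... | yes refl = ≤-reflexive (begin
      ((cw ∸ o) + t) * ht + o * ht  ≡⟨ rearr (cw ∸ o) t ht o ⟩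
      ((cw ∸ o) + o) * ht + t * ht  ≡⟨ cong (λ z → z * ht + t * ht) (m∸n+n≡m u) ⟩
      cw * ht + t * ht              ∎)
      where
      open ≡-Reasoning
      cw = c (w , [ w≢s ])
      o = outdeg w
      t = wt w w
      ht = height w
      rearr : ∀ x y z t → (x + y) * z + t * z ≡ (x + t) * z + y * z
      rearr = solve-∀
    ... | no _ = ≤-reflexive (rearr (c (w , [ w≢s ])) (wt x w) (height w))
      where
      rearr : ∀ x y z → (x + y) * z + 0 ≡ x * z + y * z
      rearr = solve-∀

    superharmonic-height : ∀ (v : Ṽ) → outflow radius (value v) < outdeg (value v) * height (value v)
    superharmonic-height v = superharmonic radius (nonsink v) (within-radius (value v))

    fire-decreases : ∀ {c} v → Unstable c v → potential (fire v c) < potential c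
    fire-decreases {c} v u = +-cancelʳ-< (outdeg (value v) * height (value v)) _ _ (begin-strict
      potential (fire v c) + outdeg (value v) * height (value v)
        ≤⟨ +-monoʳ-≤ (potential (fire v c)) (≤-trans (debit-self v) (entry≤sum (debit v) (value v))) ⟩
      potential (fire v c) + sum (debit v)
        ≡⟨ sym (∑-distrib-+ (λ w → extend (fire v c) w * height w) (debit v)) ⟩
      sum (λ w → extend (fire v c) w * height w + debit v w)
        ≤⟨ sum-mono (fire-entry {c} v u) ⟩
      sum (λ w → extend c w * height w + wt (value v) w * height w)
        ≡⟨ ∑-distrib-+ (λ w → extend c w * height w) (λ w → wt (value v) w * height w) ⟩
      potential c + outflow radius (value v)
        <⟨ +-monoʳ-< (potential c) (superharmonic-height v) ⟩
      potential c + outdeg (value v) * height (value v) ∎)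
      where open ≤-Reasoning

    unstable? : ∀ c → (∃ λ v → Unstable c v) ⊎ Stable c
    unstable? c with Fin.any? P?
      where
      P : V → Set
      P v = Σ (v ≢ sink) λ v≢s → outdeg v ≤ c (v , [ v≢s ])
      P? : ∀ v → Dec (P v)
      P? v with v Fin.≟ sink
      ... | yes v≡s = no λ (v≢s , _) → v≢s v≡s
      ... | no  v≢s with outdeg v ≤? c (v , [ v≢s ])
      ...   | yes o≤c = yes (v≢s , o≤c)
      ...   | no  o≰c = no (o≰c ∘ proj₂)
    ... | yes (v , v≢s , o≤c) = inj₁ ((v , [ v≢s ]) , o≤c)
    ... | no  none = inj₂ stable
      where
      stable : Stable c
      stable v u = none (value v , nonsink v , u)

    normalise : ∀ c → Acc _<_ (potential c) → ∃ λ d → c ⟶* d × Stable d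
    normalise c (acc rs) with unstable? c
    ... | inj₂ st      = c , done (λ _ → refl) , st
    ... | inj₁ (v , u) = let d , r , st = normalise (fire v c) (rs (fire-decreases {c} v u))
                         in d , step v u r , st

  stabilisation : ∀ c → ∃ λ d → c ⟶* d × Stable d
  stabilisation c = normalise c (<-wellFounded (potential c))

  infix 8 _°
  _° : Config → Config
  c ° = proj₁ (stabilisation c)

  ⟶*-° : ∀ c → c ⟶* c °
  ⟶*-° c = proj₁ (proj₂ (stabilisation c))

  °-stable : ∀ c → Stable (c °)
  °-stable c = proj₂ (proj₂ (stabilisation c))

  °-unique : ∀ {c d} → c ⟶* d → Stable d → c ° ≗ d
  °-unique {c} r st = stable-unique (⟶*-° c) (°-stable c) r st

  Recurrent : Config → Set
  Recurrent c = Stable c × (∀ a → ∃ λ b → (a ⊕ b) ° ≗ c)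

  °-cong : ∀ {c d} → c ≗ d → c ° ≗ d °
  °-cong {c} {d} eq = °-unique (⟶*-respˡ (λ v → sym (eq v)) (⟶*-° d)) (°-stable d)

  °-⟶* : ∀ {c d} → c ⟶* d → c ° ≗ d °
  °-⟶* {c} {d} r = °-unique (⟶*-trans r (⟶*-° d)) (°-stable d)

  stable⇒° : ∀ {c} → Stable c → c ° ≗ c
  stable⇒° st = °-unique (done (λ _ → refl)) st

  ⊕-comm° : ∀ c d → (c ⊕ d) ° ≗ (d ⊕ c) °
  ⊕-comm° c d = °-cong (λ v → +-comm (c v) (d v))

  °-⊕ˡ : ∀ c d → (c ° ⊕ d) ° ≗ (c ⊕ d) °
  °-⊕ˡ c d v = sym (°-⟶* (⟶*-⊕ d (⟶*-° c)) v)

  °-⊕ʳ : ∀ c d → (c ⊕ d °) ° ≗ (c ⊕ d) °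
  °-⊕ʳ c d v = trans (⊕-comm° c (d °) v) (trans (°-⊕ˡ d c v) (⊕-comm° d c v))

  infixl 7 _⊛_
  _⊛_ : Config → Config → Config
  c ⊛ d = (c ⊕ d) °

  ⊛-cong : ∀ {c c′ d d′} → c ≗ c′ → d ≗ d′ → c ⊛ d ≗ c′ ⊛ d′
  ⊛-cong p q = °-cong (λ v → cong₂ _+_ (p v) (q v))

  ⊛-assoc : ∀ b c d → (b ⊛ c) ⊛ d ≗ b ⊛ (c ⊛ d)
  ⊛-assoc b c d v = trans (°-⊕ˡ (b ⊕ c) d v)
    (trans (°-cong (λ w → +-assoc (b w) (c w) (d w)) v) (sym (°-⊕ʳ b (c ⊕ d) v)))

  Recurrent-⊛ : ∀ {c} d → Recurrent c → Recurrent (c ⊛ d)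
  Recurrent-⊛ {c} d (_ , rec) = °-stable (c ⊕ d) , λ a →
    let b , eq = rec a in
    b ⊕ d , λ v → trans (°-cong (λ w → sym (+-assoc (a w) (b w) (d w))) v)
                 (trans (sym (°-⊕ˡ (a ⊕ b) d v)) (⊛-cong eq (λ _ → refl) v))

  private
    outdeg>0 : ∀ (v : Ṽ) → 0 < outdeg (value v)
    outdeg>0 v = first-edge (sink-reachable (value v)) (nonsink v)
      where
      first-edge : ∀ {x} → Star Edge x sink → x ≢ sink → 0 < outdeg x
      first-edge ε           x≢s = contradiction refl x≢s
      first-edge {x} (e ◅ _) _   = ≤-trans e (entry≤sum (wt x) _)

  maximalStable : Config
  maximalStable v = pred (outdeg (value v))

  maximalStable-recurrent : Recurrent maximalStable
  maximalStable-recurrent = stable , λ a →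
    (λ v → maximalStable v ∸ (a °) v) ,
    λ v → trans (sym (°-⊕ˡ a _ v)) (trans (°-cong (λ w → m+[n∸m]≡n (a°≤ a w)) v) (stable⇒° stable v))
    where
    stable : Stable maximalStable
    stable v u with outdeg (value v) | outdeg>0 v
    ... | suc o | _ = 1+n≰n u
    a°≤ : ∀ a w → (a °) w ≤ maximalStable w
    a°≤ a w = <⇒≤pred (≰⇒> (°-stable a w))

  RecurrentConfig : Set
  RecurrentConfig = Σ Config Recurrent

  private
    _∙_ : RecurrentConfig → RecurrentConfig → RecurrentConfig
    (c , rc) ∙ (d , _) = c ⊛ d , Recurrent-⊛ d rc

    -- b₀ satisfies m ⊛ m ⊛ b₀ ≗ m, so the recurrent configuration m ⊛ b₀ acts on m, and
    -- hence on every recurrent configuration (each is of the form m ⊛ x), as an identity.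
    m : Config
    m = maximalStable

    b₀ : Config
    b₀ = proj₁ (proj₂ maximalStable-recurrent (m ⊕ m))

    e : RecurrentConfig
    e = m ⊛ b₀ , Recurrent-⊛ b₀ maximalStable-recurrent

    m⊛e : m ⊛ proj₁ e ≗ m
    m⊛e v = trans (°-⊕ʳ m (m ⊕ b₀) v)
      (trans (°-cong (λ w → sym (+-assoc (m w) (m w) (b₀ w))) v)
             (proj₂ (proj₂ maximalStable-recurrent (m ⊕ m)) v))

    ⊛-comm : ∀ c d → c ⊛ d ≗ d ⊛ c
    ⊛-comm = ⊕-comm°

    identityˡ : ∀ (c : RecurrentConfig) → proj₁ e ⊛ proj₁ c ≗ proj₁ c
    identityˡ (c , _ , rec) v = let x , eq = rec m in
      trans (⊛-cong {proj₁ e} (λ _ → refl) (λ w → sym (eq w)) v)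
      (trans (sym (⊛-assoc (proj₁ e) m x v))
      (trans (⊛-cong {d = x} (λ w → trans (⊛-comm (proj₁ e) m w) (m⊛e w)) (λ _ → refl) v) (eq v)))

    identityʳ : ∀ (c : RecurrentConfig) → proj₁ c ⊛ proj₁ e ≗ proj₁ c
    identityʳ c v = trans (⊛-comm (proj₁ c) (proj₁ e) v) (identityˡ c v)

    inv : RecurrentConfig → RecurrentConfig
    inv (c , _ , rec) = proj₁ e ⊛ proj₁ (proj₂ (proj₂ e) c) , Recurrent-⊛ _ (proj₂ e)

    inverseʳ : ∀ c → proj₁ c ⊛ proj₁ (inv c) ≗ proj₁ e
    inverseʳ c v = let x , eq = proj₂ (proj₂ e) (proj₁ c) in
      trans (sym (⊛-assoc (proj₁ c) (proj₁ e) x v))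
      (trans (⊛-cong {d = x} (identityʳ c) (λ _ → refl) v) (eq v))

    inverseˡ : ∀ c → proj₁ (inv c) ⊛ proj₁ c ≗ proj₁ e
    inverseˡ c v = trans (⊛-comm (proj₁ (inv c)) (proj₁ c) v) (inverseʳ c v)

    inv-cong : ∀ {c d} → proj₁ c ≗ proj₁ d → proj₁ (inv c) ≗ proj₁ (inv d)
    inv-cong {c} {d} eq v =
      trans (sym (identityʳ (inv c) v))
      (trans (⊛-cong {proj₁ (inv c)} (λ _ → refl) (λ w → sym (inverseʳ d w)) v)
      (trans (sym (⊛-assoc (proj₁ (inv c)) (proj₁ d) (proj₁ (inv d)) v))
      (trans (⊛-cong {d = proj₁ (inv d)}
                (λ w → trans (⊛-cong {proj₁ (inv c)} (λ _ → refl) (λ z → sym (eq z)) w) (inverseˡ c w))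
                (λ _ → refl) v)
             (identityˡ (inv d) v))))

  sandpileGroup : Group 0ℓ 0ℓ
  sandpileGroup = record
    { Carrier = RecurrentConfig
    ; _≈_     = _≗_ on proj₁
    ; _∙_     = _∙_
    ; ε       = e
    ; _⁻¹     = inv
    ; isGroup = record
      { isMonoid = record
        { isSemigroup = record
          { isMagma = record
            { isEquivalence = record
              { refl  = λ _ → refl
              ; sym   = λ p v → sym (p v)
              ; trans = λ p q v → trans (p v) (q v)
              }
            ; ∙-cong = ⊛-cong
            }
          ; assoc = λ b c d → ⊛-assoc (proj₁ b) (proj₁ c) (proj₁ d)
          }
        ; identity = identityˡ , identityʳ
        }
      ; inverse = inverseˡ , inverseʳ
      ; ⁻¹-cong = λ {c} {d} → inv-cong {c} {d}
      }
    }

record Action (G : Group a ℓ) (Γ : SandpileGraph) : Set (a ⊔ ℓ) where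
  open Group G using (Carrier; _≈_; _∙_; _⁻¹; inverseʳ) renaming (ε to 1#)
  open SandpileGraph Γ
  open Sandpile Γ using (Config; RecurrentConfig)

  infixr 7 _·_ _·̃_ _·ᶜ_
  field
    _·_         : Carrier → V → V
    ·-cong      : ∀ {g h} → g ≈ h → ∀ v → g · v ≡ h · v
    ·-identity  : ∀ v → 1# · v ≡ v
    ·-compose   : ∀ g h v → (g ∙ h) · v ≡ g · h · v
    ·-sink      : ∀ g → g · sink ≡ sink
    ·-edge      : ∀ g {v w} → Edge v w → Edge (g · v) (g · w)
    ·-weight    : ∀ g {v w} → Edge v w → wt (g · v) (g · w) ≡ wt v w

  ·-reflects-sink : ∀ g {v} → g · v ≡ sink → v ≡ sink
  ·-reflects-sink g {v} gv≡s = begin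
    v               ≡⟨ sym (·-identity v) ⟩
    1# · v          ≡⟨ ·-cong (Group.sym G (Group.inverseˡ G g)) v ⟩
    (g ⁻¹ ∙ g) · v  ≡⟨ ·-compose (g ⁻¹) g v ⟩
    g ⁻¹ · g · v    ≡⟨ cong (g ⁻¹ ·_) gv≡s ⟩
    g ⁻¹ · sink     ≡⟨ ·-sink (g ⁻¹) ⟩
    sink            ∎
    where open ≡-Reasoning

  _·̃_ : Carrier → Ṽ → Ṽ
  g ·̃ (v , [ v≢s ]) = g · v , [ (λ gv≡s → v≢s (·-reflects-sink g gv≡s)) ]

  -- The linear extension Σ c_v v ↦ Σ c_v (g v): its coefficient at v is that of c at g⁻¹ v.
  _·ᶜ_ : Carrier → Config → Config
  (g ·ᶜ c) v = c (g ⁻¹ ·̃ v)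

  SymmetricConfig : Config → Set a
  SymmetricConfig c = ∀ g → g ·ᶜ c ≗ c

  SymmetricRecurrent : RecurrentConfig → Set a
  SymmetricRecurrent (c , _) = SymmetricConfig c

{-# OPTIONS --safe #-}

-- Relabelling the vertices by g carries firing sequences to firing sequences and stable
-- configurations to stable ones, so by uniqueness of stabilisation g (c °) = (g c) °.  Hence g
-- acts on the sandpile group by automorphisms, and the fixed points of automorphisms form a
-- subgroup.
module Submission where

open import Level using (Level)
open import Algebra.Bundles using (Group)
open import Defs

import Algebra.Properties.CommutativeMonoid.Sum as CMSum
import Algebra.Properties.Group as GroupProperties
open import Data.Fin.Permutation using (Permutation′; permutation)
import Data.Fin.Properties as Fin
open import Data.Irrelevant using ([_])
open import Data.Nat.Base using (_+_; _∸_; _≤_)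
open import Data.Nat.Properties using (+-0-commutativeMonoid; _<?_; n≤0⇒n≡0; ≮⇒≥)
open import Data.Product.Base using (_,_; proj₁)
open import Data.Refinement.Base using (_,_; value)
open import Function.Base using (_∘_)
open import Relation.Binary.PropositionalEquality
open import Relation.Nullary.Decidable.Core using (yes; no)
open import Relation.Nullary.Negation.Core using (contradiction)

open CMSum +-0-commutativeMonoid using (sum-cong-≗; sum-permute)

module _ {a ℓ : Level} {G : Group a ℓ} {Γ : SandpileGraph} (α : Action G Γ) where
  open Group G using (Carrier; _⁻¹; inverseˡ; inverseʳ)
  open SandpileGraph Γ
  open Sandpile Γ
  open Action α

  private
    module S = Group sandpileGroup

  Ṽ-≡ : {u v : Ṽ} → value u ≡ value v → u ≡ v
  Ṽ-≡ {_ , [ _ ]} {_ , [ _ ]} refl = refl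

  ·-inverseˡ : ∀ g v → g ⁻¹ · g · v ≡ v
  ·-inverseˡ g v = trans (sym (·-compose (g ⁻¹) g v)) (trans (·-cong (inverseˡ g) v) (·-identity v))

  ·-inverseʳ : ∀ g v → g · g ⁻¹ · v ≡ v
  ·-inverseʳ g v = trans (sym (·-compose g (g ⁻¹) v)) (trans (·-cong (inverseʳ g) v) (·-identity v))

  ·-permutation : Carrier → Permutation′ order
  ·-permutation g = permutation (g ·_) (g ⁻¹ ·_) (·-inverseʳ g) (·-inverseˡ g)

  ·-reflects-edge : ∀ g {v w} → Edge (g · v) (g · w) → Edge v w
  ·-reflects-edge g {v} {w} e = subst₂ Edge (·-inverseˡ g v) (·-inverseˡ g w) (·-edge (g ⁻¹) e)

  -- `·-weight` covers only edges. A non-edge goes to a non-edge, because `g ⁻¹` would carry an edge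
  -- between the images back; both weights are then 0.
  wt-invariant : ∀ g v w → wt (g · v) (g · w) ≡ wt v w
  wt-invariant g v w with 0 <? wt v w
  ... | yes e = ·-weight g e
  ... | no ¬e = trans (n≤0⇒n≡0 (≮⇒≥ (¬e ∘ ·-reflects-edge g))) (sym (n≤0⇒n≡0 (≮⇒≥ ¬e)))

  -- Moving `g` across as `g ⁻¹` matches the convention of `·ᶜ`, which reads a coefficient at the
  -- preimage of a vertex.
  wt-adjoint : ∀ g v w → wt (g · v) w ≡ wt v (g ⁻¹ · w)
  wt-adjoint g v w = trans (cong (wt (g · v)) (sym (·-inverseʳ g w))) (wt-invariant g v (g ⁻¹ · w))

  outdeg-invariant : ∀ g v → outdeg (g · v) ≡ outdeg v
  outdeg-invariant g v =
    trans (sum-permute (wt (g · v)) (·-permutation g)) (sum-cong-≗ (wt-invariant g v))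

  -- The tests `g · x ≡ w` and `x ≡ g ⁻¹ · w` are equivalent, so only the two agreeing outcomes can
  -- occur.
  loss-adjoint : ∀ g v w → loss (g ·̃ v) w ≡ loss v (g ⁻¹ · w)
  loss-adjoint g v@(x , [ _ ]) w with g · x Fin.≟ w | x Fin.≟ g ⁻¹ · w
  ... | yes _    | yes _   = outdeg-invariant g x
  ... | no _     | no _    = refl
  ... | yes refl | no x≢   = contradiction (sym (·-inverseˡ g x)) x≢
  ... | no gx≢w  | yes x≡  = contradiction (trans (cong (g ·_) x≡) (·-inverseʳ g w)) gx≢w

  fire-equivariant : ∀ g v c → fire (g ·̃ v) (g ·ᶜ c) ≗ g ·ᶜ fire v c
  fire-equivariant g v@(x , [ _ ]) c w@(y , [ _ ]) =
    cong₂ (λ l t → (c (g ⁻¹ ·̃ w) ∸ l) + t) (loss-adjoint g v y) (wt-adjoint g x y)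

  ·-unstable : ∀ g {c} v → Unstable c v → Unstable (g ·ᶜ c) (g ·̃ v)
  ·-unstable g {c} v@(x , [ _ ]) =
    subst₂ _≤_ (sym (outdeg-invariant g x)) (cong c (Ṽ-≡ (sym (·-inverseˡ g x))))

  ·-⟶* : ∀ g {c d} → c ⟶* d → g ·ᶜ c ⟶* g ·ᶜ d
  ·-⟶* g (done eq)        = done (λ v → eq (g ⁻¹ ·̃ v))
  ·-⟶* g {c} (step v u r) = step (g ·̃ v) (·-unstable g {c} v u)
    (⟶*-respˡ (λ w → sym (fire-equivariant g v c w)) (·-⟶* g r))

  -- Instability of `g ·ᶜ c` at `v` is instability of `c` at `g ⁻¹ ·̃ v`, since the two vertices
  -- have equal outdegree.
  ·-stable : ∀ g {c} → Stable c → Stable (g ·ᶜ c)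
  ·-stable g {c} st v@(x , [ _ ]) u =
    st (g ⁻¹ ·̃ v) (subst (_≤ c (g ⁻¹ ·̃ v)) (sym (outdeg-invariant (g ⁻¹) x)) u)

  °-equivariant : ∀ g c → (g ·ᶜ c) ° ≗ g ·ᶜ (c °)
  °-equivariant g c = °-unique (·-⟶* g (⟶*-° c)) (·-stable g (°-stable c))

  ·-recurrent : ∀ g {c} → Recurrent c → Recurrent (g ·ᶜ c)
  ·-recurrent g {c} (st , rec) = ·-stable g st , λ a →
    -- `a ∘ (g ·̃_)` is the translate of `a` by the inverse of `g`. If adding `b` to it stabilises
    -- to `c`, then translating by `g` shows that `a ⊕ (g ·ᶜ b)` stabilises to `g ·ᶜ c`.
    let b , eq = rec (a ∘ (g ·̃_)) in
    g ·ᶜ b , λ v → trans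
      (°-cong (λ { w@(y , [ _ ]) → cong (λ z → a z + b (g ⁻¹ ·̃ w)) (Ṽ-≡ (sym (·-inverseʳ g y))) }) v)
      (trans (°-equivariant g ((a ∘ (g ·̃_)) ⊕ b) v) (eq (g ⁻¹ ·̃ v)))

  infixr 7 _·ʳ_
  _·ʳ_ : Carrier → RecurrentConfig → RecurrentConfig
  g ·ʳ (c , rc) = g ·ᶜ c , ·-recurrent g rc

  ·ʳ-cong : ∀ g {x y} → x S.≈ y → g ·ʳ x S.≈ g ·ʳ y
  ·ʳ-cong g x≈y v = x≈y (g ⁻¹ ·̃ v)

  ·ʳ-homo : ∀ g x y → g ·ʳ (x S.∙ y) S.≈ (g ·ʳ x) S.∙ (g ·ʳ y)
  ·ʳ-homo g x y v = sym (°-equivariant g (proj₁ x ⊕ proj₁ y) v)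

proposition2p6 : {a ℓ : Level} (G : Group a ℓ) → Finite G →
    (Γ : SandpileGraph) (α : Action G Γ) →
    IsSubgroup (Sandpile.sandpileGroup Γ) (Action.SymmetricRecurrent α)
proposition2p6 G _ Γ α = record
  { respects  = λ {x} {y} x≈y sx g →
      S.trans {g · y} {g · x} {y} (·ʳ-cong α g {y} {x} (S.sym {x} {y} x≈y))
        (S.trans {g · x} {x} {y} (sx g) x≈y)
  ; ε-closed  = ε-fixed
  ; ∙-closed  = λ {x} {y} sx sy g →
      S.trans {g · (x S.∙ y)} {(g · x) S.∙ (g · y)} {x S.∙ y} (·ʳ-homo α g x y)
        (S.∙-cong {g · x} {x} {g · y} {y} (sx g) (sy g))
  -- As `x` is fixed by `g`, the translate of its inverse is again a right inverse of `x`, and right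
  -- inverses are unique.
  ; ⁻¹-closed = λ {x} sx g → inverseʳ-unique x (g · (x S.⁻¹)) (begin
      x S.∙ (g · (x S.⁻¹))
        ≈⟨ S.∙-cong {g · x} {x} {g · (x S.⁻¹)} {g · (x S.⁻¹)} (sx g) (λ _ → refl) ⟨
      (g · x) S.∙ (g · (x S.⁻¹))  ≈⟨ ·ʳ-homo α g x (x S.⁻¹) ⟨
      g · (x S.∙ (x S.⁻¹))        ≈⟨ ·ʳ-cong α g {x S.∙ (x S.⁻¹)} {S.ε} (S.inverseʳ x) ⟩
      g · S.ε                     ≈⟨ ε-fixed g ⟩
      S.ε                         ∎)
  }
  where
  module S = Group (Sandpile.sandpileGroup Γ)
  open GroupProperties (Sandpile.sandpileGroup Γ) using (identityʳ-unique; inverseʳ-unique)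
  open import Relation.Binary.Reasoning.Setoid S.setoid

  infixr 8 _·_
  _·_ : Group.Carrier G → S.Carrier → S.Carrier
  _·_ = _·ʳ_ α

  -- The neutral element is built from a chosen witness of recurrence, so its symmetry cannot be
  -- read off its formula. Its translate is idempotent, however, and the only idempotent of a group
  -- is the identity.
  ε-fixed : ∀ g → g · S.ε S.≈ S.ε
  ε-fixed g = identityʳ-unique (g · S.ε) (g · S.ε) (begin
    (g · S.ε) S.∙ (g · S.ε)  ≈⟨ ·ʳ-homo α g S.ε S.ε ⟨
    g · (S.ε S.∙ S.ε)        ≈⟨ ·ʳ-cong α g {S.ε S.∙ S.ε} {S.ε} (S.identityˡ S.ε) ⟩
    g · S.ε                  ∎)
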